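{- Let $G$ be a connected non-bipartite graph and let $n\geq 7$ be an odd integer. If $\kappa(G\times K_{2})>\frac{4}{n-1}\delta(G)$, then $G\times C_{n}$ is super-$\kappa$.
   Context: All graphs are simple. $C_n$ is the cycle on $n$ vertices and $K_2$ the complete graph on 2 vertices. The direct product $G\times H$ has vertex set $V(G)\times V(H)$, with $(u_1,v_1)(u_2,v_2)$ an edge iff $u_1u_2\in E(G)$ and $v_1v_2\in E(H)$. $\delta(G)$ is the minimum degree. For a non-complete graph $G$, the connectivity $\kappa(G)$ is the minimum size of a vertex set $S$ such that $G-S$ is disconnected; for a complete graph $\kappa(G)=|V(G)|-1$. A graph is super connected (super-$\kappa$) if every minimum vertex cut is the neighborhood of some vertex of minimum degree. -}

module Defs where

open import Data.Nat using (ℕ; zero; suc; _∸_; _≡ᵇ_; _≤_)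
open import Data.Bool using (Bool; true; false; not; _∧_; _∨_; T)
open import Data.Fin using (Fin; toℕ; remQuot)
open import Data.Fin.Subset using (Subset; _∉_; ∣_∣; ⊥)
open import Data.Vec using (tabulate)
open import Data.Product using (Σ; ∃; _×_; _,_; proj₁; proj₂)
open import Relation.Binary.PropositionalEquality using (_≡_; _≢_)
open import Relation.Nullary using (¬_)

Graph : ℕ → Set
Graph n = Fin n → Fin n → Bool

Adj : ∀ {n} → Graph n → Fin n → Fin n → Set
Adj G u v = T (G u v)

Simple : ∀ {n} → Graph n → Set
Simple {n} G = (∀ u v → G u v ≡ G v u) × (∀ u → G u u ≡ false)

nbhd : ∀ {n} → Graph n → Fin n → Subset n
nbhd G v = tabulate (G v)

deg : ∀ {n} → Graph n → Fin n → ℕ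
deg G v = ∣ nbhd G v ∣

IsMinDegree : ∀ {n} → Graph n → ℕ → Set
IsMinDegree G d = (∃ λ v → deg G v ≡ d) × (∀ v → d ≤ deg G v)

data Reach {n} (G : Graph n) (S : Subset n) : Fin n → Fin n → Set where
  here : ∀ {u} → u ∉ S → Reach G S u u
  step : ∀ {u w v} → u ∉ S → Adj G u w → Reach G S w v → Reach G S u v

Connected : ∀ {n} → Graph n → Set
Connected G = ∀ u v → Reach G ⊥ u v

Bipartite : ∀ {n} → Graph n → Set
Bipartite {n} G = Σ (Fin n → Bool) λ c → ∀ u v → Adj G u v → c u ≢ c v

Complete : ∀ {n} → Graph n → Set
Complete G = ∀ u v → u ≢ v → Adj G u v

IsVertexCut : ∀ {n} → Graph n → Subset n → Set
IsVertexCut G S = ∃ λ u → ∃ λ v → u ∉ S × v ∉ S × ¬ Reach G S u v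

IsConnectivity : ∀ {n} → Graph n → ℕ → Set
IsConnectivity {n} G k =
  (Complete G → k ≡ n ∸ 1) ×
  (¬ Complete G →
     (∃ λ S → IsVertexCut G S × ∣ S ∣ ≡ k) × (∀ S → IsVertexCut G S → k ≤ ∣ S ∣))

SuperKappa : ∀ {n} → Graph n → Set
SuperKappa {n} G = ∀ k → IsConnectivity G k → ∀ S → IsVertexCut G S → ∣ S ∣ ≡ k →
  ∃ λ v → (∀ w → deg G v ≤ deg G w) × S ≡ nbhd G v

_×ᴳ_ : ∀ {m n} → Graph m → Graph n → Graph (m Data.Nat.* n)
_×ᴳ_ {m} {n} G H p q with remQuot n p | remQuot n q
... | (u₁ , v₁) | (u₂ , v₂) = G u₁ u₂ ∧ H v₁ v₂

K₂ : Graph 2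
K₂ i j = not (toℕ i ≡ᵇ toℕ j)

Cycle : (n : ℕ) → Graph n
Cycle n i j = succ i j ∨ succ j i
  where
  succ : Fin n → Fin n → Bool
  succ a b = (toℕ b ≡ᵇ suc (toℕ a)) ∨ ((suc (toℕ a) ≡ᵇ n) ∧ (toℕ b ≡ᵇ 0))

{-# OPTIONS --safe #-}
-- Let S be a minimum cut of G × Cₙ and d the minimum degree of G, so |S| ≤ 2d. If S contains some N(x),
-- it equals N(x) and x has minimum degree; otherwise every vertex has a neighbour outside S. Write sᵢ for
-- the number of vertices of S in the layer V(G) × {i}. The average of sᵢ + sᵢ₊₁ is below k = κ(G × K₂), so
-- two consecutive layers have fewer than k vertices of S and stay connected to each other, since they
-- span a copy of G × K₂. A layer in this component with sᵢ < d pulls in both neighbouring layers, as every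
-- vertex there keeps a neighbour in it. Since Σ sᵢ ≤ 2d, this spreads to all layers unless exactly two
-- layers have sᵢ = d and all others are empty. An arc between these two consisting of a single layer is
-- attached because no vertex is isolated; in a longer arc two adjacent empty layers are connected to each other.
module Submission where

open import Defs
open import Data.Nat using (ℕ; zero; suc; _+_; _*_; _∸_; _<_; _≤_; z≤n; s≤s; z<s; NonZero; _≡ᵇ_; _<?_; _≤?_)
open import Data.Nat.Properties
open import Data.Nat.DivMod using (_%_; _mod_; m%n<n; m<n⇒m%n≡m; n%n≡0; m%n%n≡m%n; [m+n]%n≡m%n; %-distribˡ-+)
open import Data.Nat.Divisibility using (_∣_)
open import Data.Bool using (Bool; true; false; _∧_; _∨_; T; if_then_else_)
open import Data.Bool.Properties using (T-∧; T-∨; T-≡; ∨-comm)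
open import Data.Fin using (Fin; zero; suc; toℕ; combine; remQuot; _↑ˡ_; _↑ʳ_; punchOut)
open import Data.Fin.Properties using (toℕ-injective; toℕ-fromℕ<; toℕ<n; remQuot-combine; combine-surjective; combine-injectiveʳ; any?; punchIn-punchOut; punchOut-injective)
open import Data.Fin.Permutation using (Permutation′; permutation)
open import Data.Fin.Subset using (Subset; _∈_; _∉_; _⊆_; ∣_∣; ⊤; ⁅_⁆)
open import Data.Fin.Subset.Properties
open import Data.Vec using (lookup; tabulate; []; _∷_)
open import Data.Vec.Properties using (lookup∘tabulate; lookup⇒[]=; []=⇒lookup; tabulate-cong)
open import Data.Product using (∃; _×_; _,_; proj₁; proj₂)
open import Data.Sum using (_⊎_; inj₁; inj₂)
open import Function using (_∘_; case_of_; Equivalence)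
open import Relation.Binary.PropositionalEquality
open import Relation.Nullary using (¬_; yes; no; contradiction)
open import Relation.Nullary.Decidable using (_×-dec_; ¬?; decidable-stable)
open import Algebra.Properties.CommutativeMonoid.Sum +-0-commutativeMonoid using (sum; sum-cong-≗; sum-remove; ∑-distrib-+; ∑-comm; sum-permute)
open import Algebra.Properties.Semiring.Sum +-*-semiring using (*-distribˡ-sum; *-distribʳ-sum)
open import Data.Vec.Functional using (removeAt)

-- Finite sums: bounds by a few terms, averaging, and double sums.

term≤sum : ∀ {n} (f : Fin n → ℕ) i → f i ≤ sum f
term≤sum {suc n} f i = subst (f i ≤_) (sym (sum-remove f)) (m≤m+n _ _)

twoTerms≤sum : ∀ {n} (f : Fin n → ℕ) {i j} → i ≢ j → f i + f j ≤ sum f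
twoTerms≤sum {suc n} f {i} {j} i≢j = subst (f i + f j ≤_) (sym (sum-remove f))
  (+-monoʳ-≤ (f i) (subst (_≤ sum (removeAt f i)) (cong f (punchIn-punchOut i≢j)) (term≤sum (removeAt f i) (punchOut i≢j))))

threeTerms≤sum : ∀ {n} (f : Fin n → ℕ) {i j l} → i ≢ j → i ≢ l → j ≢ l → f i + (f j + f l) ≤ sum f
threeTerms≤sum {suc n} f {i} {j} {l} i≢j i≢l j≢l = subst (f i + (f j + f l) ≤_) (sym (sum-remove f))
  (+-monoʳ-≤ (f i) (subst₂ (λ a b → f a + f b ≤ sum (removeAt f i)) (punchIn-punchOut i≢j) (punchIn-punchOut i≢l)
    (twoTerms≤sum (removeAt f i) (j≢l ∘ punchOut-injective i≢j i≢l))))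

-- Averaging by induction: a first term of at least `k` can be cancelled against one copy of `k`,
-- leaving the same inequality for the tail.
sum<⇒∃< : ∀ {n} (f : Fin n → ℕ) {k} → sum f < n * k → ∃ λ i → f i < k
sum<⇒∃< {suc n} f {k} lt with f zero <? k
... | yes p = zero , p
... | no ¬p with sum<⇒∃< (f ∘ suc) {k} (+-cancelˡ-< k _ _ (≤-<-trans (+-monoˡ-≤ _ (≮⇒≥ ¬p)) lt))
...   | i , q = suc i , q

sum-↑ : ∀ m {n} (f : Fin (m + n) → ℕ) → sum f ≡ sum (λ i → f (i ↑ˡ n)) + sum (λ i → f (m ↑ʳ i))
sum-↑ zero    f = refl
sum-↑ (suc m) f = trans (cong (f zero +_) (sum-↑ m (f ∘ suc))) (sym (+-assoc (f zero) _ _))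

sum-combine : ∀ m {n} (f : Fin (m * n) → ℕ) → sum f ≡ sum (λ i → sum (λ j → f (combine {m} {n} i j)))
sum-combine zero    f = refl
sum-combine (suc m) {n} f = trans (sum-↑ n f) (cong (sum (λ j → f (j ↑ˡ (m * n))) +_) (sum-combine m (λ i → f (n ↑ʳ i))))

-- Subsets, their cardinalities and preimages.

χ : Bool → ℕ
χ b = if b then 1 else 0

χ-∧ : ∀ a b → χ (a ∧ b) ≡ χ a * χ b
χ-∧ true  b = sym (+-identityʳ (χ b))
χ-∧ false b = refl

χ-∨ : ∀ a b → ¬ (T a × T b) → χ (a ∨ b) ≡ χ a + χ b
χ-∨ true  true  h = contradiction _ h
χ-∨ true  false h = refl
χ-∨ false b     h = refl

∣tabulate∣ : ∀ {n} (f : Fin n → Bool) → ∣ tabulate f ∣ ≡ sum (χ ∘ f)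
∣tabulate∣ {zero}  f = refl
∣tabulate∣ {suc n} f with f zero
... | true  = cong suc (∣tabulate∣ (f ∘ suc))
... | false = ∣tabulate∣ (f ∘ suc)

∣p∣≡∑χ : ∀ {n} (p : Subset n) → ∣ p ∣ ≡ sum (χ ∘ lookup p)
∣p∣≡∑χ []          = refl
∣p∣≡∑χ (true ∷ p)  = cong suc (∣p∣≡∑χ p)
∣p∣≡∑χ (false ∷ p) = ∣p∣≡∑χ p

∈-tabulate⁺ : ∀ {n} (f : Fin n → Bool) {x} → T (f x) → x ∈ tabulate f
∈-tabulate⁺ f {x} t = lookup⇒[]= x _ (trans (lookup∘tabulate f x) (Equivalence.to T-≡ t))

∈-tabulate⁻ : ∀ {n} (f : Fin n → Bool) {x} → x ∈ tabulate f → T (f x)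
∈-tabulate⁻ f {x} x∈ = Equivalence.from T-≡ (trans (sym (lookup∘tabulate f x)) ([]=⇒lookup x∈))

preimage : ∀ {m n} → (Fin m → Fin n) → Subset n → Subset m
preimage φ p = tabulate (lookup p ∘ φ)

∈-preimage⁺ : ∀ {m n} (φ : Fin m → Fin n) (p : Subset n) {x} → φ x ∈ p → x ∈ preimage φ p
∈-preimage⁺ φ p {x} φx∈p = lookup⇒[]= x _ (trans (lookup∘tabulate _ x) ([]=⇒lookup φx∈p))

∈-preimage⁻ : ∀ {m n} (φ : Fin m → Fin n) (p : Subset n) {x} → x ∈ preimage φ p → φ x ∈ p
∈-preimage⁻ φ p {x} x∈ = lookup⇒[]= (φ x) p (trans (sym (lookup∘tabulate _ x)) ([]=⇒lookup x∈))

⊈⇒∃ : ∀ {n} (p q : Subset n) → ¬ p ⊆ q → ∃ λ x → x ∈ p × x ∉ q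
⊈⇒∃ p q p⊈q with any? (λ x → (x ∈? p) ×-dec ¬? (x ∈? q))
... | yes e = e
... | no ¬e = contradiction (λ {x} x∈p → decidable-stable (x ∈? q) (λ x∉q → ¬e (x , x∈p , x∉q))) p⊈q

∣∣<⇒∃ : ∀ {n} (p q : Subset n) → ∣ q ∣ < ∣ p ∣ → ∃ λ x → x ∈ p × x ∉ q
∣∣<⇒∃ p q lt = ⊈⇒∃ p q (λ p⊆q → <⇒≱ lt (p⊆q⇒∣p∣≤∣q∣ p⊆q))

⊆∧∣∣≥⇒≡ : ∀ {n} (p q : Subset n) → p ⊆ q → ∣ q ∣ ≤ ∣ p ∣ → q ≡ p
⊆∧∣∣≥⇒≡ p q p⊆q le = ⊆-antisym q⊆p p⊆q
  where
  q⊆p : q ⊆ p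
  q⊆p {x} x∈q = decidable-stable (x ∈? p) (λ x∉p → <⇒≱ (p⊂q⇒∣p∣<∣q∣ (p⊆q , x , x∈q , x∉p)) le)

∉⇒∣∣<n : ∀ {n} {p : Subset n} {x} → x ∉ p → ∣ p ∣ < n
∉⇒∣∣<n {n} {p} {x} x∉p = subst (∣ p ∣ <_) (∣⊤∣≡n n) (p⊂q⇒∣p∣<∣q∣ (⊆⊤ , x , ∈⊤ , x∉p))

-- Splitting a vertex set of a product into layers.

slice : ∀ m {n} → Subset (m * n) → Fin n → Subset m
slice m S j = preimage (λ u → combine u j) S

-- `combine` enumerates fibre by fibre while layers fix the second coordinate, so the two summations
-- have to be exchanged.
∣S∣≡∑∣slice∣ : ∀ m n (S : Subset (m * n)) → ∣ S ∣ ≡ sum (λ j → ∣ slice m S j ∣)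
∣S∣≡∑∣slice∣ m n S = begin
  ∣ S ∣                                                       ≡⟨ ∣p∣≡∑χ S ⟩
  sum (χ ∘ lookup S)                                          ≡⟨ sum-combine m (χ ∘ lookup S) ⟩
  sum (λ u → sum (λ j → χ (lookup S (combine {m} {n} u j))))  ≡⟨ ∑-comm (λ u j → χ (lookup S (combine {m} {n} u j))) ⟩
  sum (λ j → sum (λ u → χ (lookup S (combine {m} {n} u j))))  ≡⟨ sum-cong-≗ {n} (λ j → sym (∣tabulate∣ (λ u → lookup S (combine {m} {n} u j)))) ⟩
  sum (λ j → ∣ slice m S j ∣)                           ∎
  where open ≡-Reasoning

-- Arithmetic modulo `n` and the cycle graph.

module _ {n} .{{_ : NonZero n}} where

  layer : ℕ → Fin n
  layer t = t mod n

  toℕ-layer : ∀ t → toℕ (layer t) ≡ t % n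
  toℕ-layer t = toℕ-fromℕ< (m%n<n t n)

  layer-toℕ : ∀ i → layer (toℕ i) ≡ i
  layer-toℕ i = toℕ-injective (trans (toℕ-layer (toℕ i)) (m<n⇒m%n≡m (toℕ<n i)))

  layer-+ : ∀ a b → layer (a + toℕ (layer b)) ≡ layer (a + b)
  layer-+ a b = toℕ-injective (begin
    toℕ (layer (a + toℕ (layer b)))  ≡⟨ toℕ-layer _ ⟩
    (a + toℕ (layer b)) % n          ≡⟨ cong (λ z → (a + z) % n) (toℕ-layer b) ⟩
    (a + b % n) % n                  ≡⟨ %-distribˡ-+ a (b % n) n ⟩
    (a % n + b % n % n) % n          ≡⟨ cong (λ z → (a % n + z) % n) (m%n%n≡m%n b n) ⟩
    (a % n + b % n) % n              ≡⟨ sym (%-distribˡ-+ a b n) ⟩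
    (a + b) % n                      ≡⟨ sym (toℕ-layer _) ⟩
    toℕ (layer (a + b))              ∎)
    where open ≡-Reasoning

  layer-n+ : ∀ t → layer (n + t) ≡ layer t
  layer-n+ t = toℕ-injective (begin
    toℕ (layer (n + t))  ≡⟨ toℕ-layer _ ⟩
    (n + t) % n          ≡⟨ cong (_% n) (+-comm n t) ⟩
    (t + n) % n          ≡⟨ [m+n]%n≡m%n t n ⟩
    t % n                ≡⟨ sym (toℕ-layer _) ⟩
    toℕ (layer t)        ∎)
    where open ≡-Reasoning

  layer-cancel : ∀ a b i → a + b ≡ n → layer (a + toℕ (layer (b + toℕ i))) ≡ i
  layer-cancel a b i a+b≡n = begin
    layer (a + toℕ (layer (b + toℕ i)))  ≡⟨ layer-+ a _ ⟩
    layer (a + (b + toℕ i))              ≡⟨ cong layer (sym (+-assoc a b _)) ⟩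
    layer (a + b + toℕ i)                ≡⟨ cong (λ z → layer (z + toℕ i)) a+b≡n ⟩
    layer (n + toℕ i)                    ≡⟨ layer-n+ _ ⟩
    layer (toℕ i)                        ≡⟨ layer-toℕ i ⟩
    i                                    ∎
    where open ≡-Reasoning

  rotation : ∀ p → p ≤ n → Permutation′ n
  rotation p p≤n = permutation (λ i → layer (p + toℕ i)) (λ i → layer (n ∸ p + toℕ i))
    (λ i → layer-cancel p (n ∸ p) i (m+[n∸m]≡n p≤n))
    (λ i → layer-cancel (n ∸ p) p i (m∸n+n≡m p≤n))

  -- Shifting on by `n ∸ p` completes a full turn and recovers the offset, which is its own residue
  -- because it is below `n`.
  layer-injective : ∀ {p u v} → p ≤ n → u < n → v < n → layer (p + u) ≡ layer (p + v) → u ≡ v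
  layer-injective {p} {u} {v} p≤n u<n v<n eq = begin
    u                                             ≡⟨ sym (shift u u<n) ⟩
    toℕ (layer (n ∸ p + toℕ (layer (p + u))))     ≡⟨ cong (λ i → toℕ (layer (n ∸ p + toℕ i))) eq ⟩
    toℕ (layer (n ∸ p + toℕ (layer (p + v))))     ≡⟨ shift v v<n ⟩
    v                                             ∎
    where
    open ≡-Reasoning
    shift : ∀ t → t < n → toℕ (layer (n ∸ p + toℕ (layer (p + t)))) ≡ t
    shift t t<n = begin
      toℕ (layer (n ∸ p + toℕ (layer (p + t))))   ≡⟨ cong toℕ (layer-+ (n ∸ p) (p + t)) ⟩
      toℕ (layer (n ∸ p + (p + t)))               ≡⟨ cong (toℕ ∘ layer) (sym (+-assoc (n ∸ p) p t)) ⟩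
      toℕ (layer (n ∸ p + p + t))                 ≡⟨ cong (λ z → toℕ (layer (z + t))) (m∸n+n≡m p≤n) ⟩
      toℕ (layer (n + t))                         ≡⟨ cong toℕ (layer-n+ t) ⟩
      toℕ (layer t)                               ≡⟨ toℕ-layer t ⟩
      t % n                                       ≡⟨ m<n⇒m%n≡m t<n ⟩
      t                                           ∎

  next : Fin n → Fin n
  next i = layer (suc (toℕ i))

  next-layer : ∀ t → next (layer t) ≡ layer (suc t)
  next-layer t = layer-+ 1 t

  next-injective : ∀ {i j} → next i ≡ next j → i ≡ j
  next-injective {i} {j} eq = begin
    i                              ≡⟨ sym (back i) ⟩
    layer (n ∸ 1 + toℕ (next i))   ≡⟨ cong (λ l → layer (n ∸ 1 + toℕ l)) eq ⟩
    layer (n ∸ 1 + toℕ (next j))   ≡⟨ back j ⟩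
    j                              ∎
    where
    open ≡-Reasoning
    back : ∀ l → layer (n ∸ 1 + toℕ (next l)) ≡ l
    back l = layer-cancel (n ∸ 1) 1 l (m∸n+n≡m (≤-<-trans z≤n (toℕ<n l)))

  next-surjective : ∀ i → ∃ λ j → next j ≡ i
  next-surjective i = layer (n ∸ 1 + toℕ i) , layer-cancel 1 (n ∸ 1) i (m+[n∸m]≡n (≤-<-trans z≤n (toℕ<n i)))

  next²≢id : 2 < n → ∀ i → next (next i) ≢ i
  next²≢id 2<n i eq = case layer-injective (<⇒≤ (toℕ<n i)) 2<n (<-trans z<s 2<n) (begin
    layer (toℕ i + 2)    ≡⟨ cong layer (+-comm (toℕ i) 2) ⟩
    layer (2 + toℕ i)    ≡⟨ sym (next-layer (suc (toℕ i))) ⟩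
    next (next i)        ≡⟨ eq ⟩
    i                    ≡⟨ sym (layer-toℕ i) ⟩
    layer (toℕ i)        ≡⟨ cong layer (sym (+-identityʳ (toℕ i))) ⟩
    layer (toℕ i + 0)    ∎) of λ ()
    where open ≡-Reasoning

  -- Repeats the local `succ` of `Cycle`, so that `Cycle n a b` unfolds to
  -- `isNext a b ∨ isNext b a`.
  isNext : Fin n → Fin n → Bool
  isNext a b = (toℕ b ≡ᵇ suc (toℕ a)) ∨ ((suc (toℕ a) ≡ᵇ n) ∧ (toℕ b ≡ᵇ 0))

  isNext⇒≡next : ∀ a b → T (isNext a b) → b ≡ next a
  isNext⇒≡next a b t = toℕ-injective (trans (b≡ (Equivalence.to T-∨ t)) (sym (toℕ-layer (suc (toℕ a)))))
    where
    b≡ : T (toℕ b ≡ᵇ suc (toℕ a)) ⊎ T ((suc (toℕ a) ≡ᵇ n) ∧ (toℕ b ≡ᵇ 0)) → toℕ b ≡ suc (toℕ a) % n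
    b≡ (inj₁ t₁) with ≡ᵇ⇒≡ (toℕ b) _ t₁
    ... | eq = trans eq (sym (m<n⇒m%n≡m (subst (_< n) eq (toℕ<n b))))
    b≡ (inj₂ t₂) with Equivalence.to (T-∧ {suc (toℕ a) ≡ᵇ n}) t₂
    ... | p , q = trans (≡ᵇ⇒≡ (toℕ b) 0 q) (sym (trans (cong (_% n) (≡ᵇ⇒≡ (suc (toℕ a)) n p)) (n%n≡0 n)))

  isNext-next : ∀ a → T (isNext a (next a))
  isNext-next a with m≤n⇒m<n∨m≡n (toℕ<n a)
  ... | inj₁ lt = Equivalence.from T-∨ (inj₁ (≡⇒≡ᵇ (toℕ (next a)) _ (trans (toℕ-layer _) (m<n⇒m%n≡m lt))))
  ... | inj₂ eq = Equivalence.from (T-∨ {toℕ (next a) ≡ᵇ suc (toℕ a)}) (inj₂ (Equivalence.from T-∧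
        (≡⇒≡ᵇ (suc (toℕ a)) n eq , ≡⇒≡ᵇ (toℕ (next a)) 0 (trans (toℕ-layer _) (trans (cong (_% n) eq) (n%n≡0 n))))))

  Cycle-next : ∀ a → Adj (Cycle n) a (next a)
  Cycle-next a = Equivalence.from T-∨ (inj₁ (isNext-next a))

  Cycle-sym : ∀ a b → Cycle n a b ≡ Cycle n b a
  Cycle-sym a b = ∨-comm (isNext a b) (isNext b a)

  Cycle-next⁻ : ∀ a → Adj (Cycle n) (next a) a
  Cycle-next⁻ a = subst T (Cycle-sym a (next a)) (Cycle-next a)

  Cycle⇒next : ∀ a b → Adj (Cycle n) a b → b ≡ next a ⊎ a ≡ next b
  Cycle⇒next a b t with Equivalence.to (T-∨ {isNext a b}) t
  ... | inj₁ p = inj₁ (isNext⇒≡next a b p)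
  ... | inj₂ p = inj₂ (isNext⇒≡next b a p)

  -- The successor and the predecessor contribute one each; `2 < n` keeps them distinct.
  deg-Cycle : 2 < n → ∀ i → deg (Cycle n) i ≡ 2
  deg-Cycle 2<n i with next-surjective i
  ... | j , refl = begin
    deg (Cycle n) i                                        ≡⟨ ∣tabulate∣ (Cycle n i) ⟩
    sum (λ l → χ (isNext i l ∨ isNext l i))                ≡⟨ sum-cong-≗ (λ l → χ-∨ (isNext i l) (isNext l i) (disjoint l)) ⟩
    sum (λ l → χ (isNext i l) + χ (isNext l i))            ≡⟨ ∑-distrib-+ (χ ∘ isNext i) (λ l → χ (isNext l i)) ⟩
    sum (χ ∘ isNext i) + sum (λ l → χ (isNext l i))        ≡⟨ cong₂ _+_ (unique (isNext i) (isNext-next i) (λ l → isNext⇒≡next i l))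
                                                                (unique (λ l → isNext l i) (isNext-next j) (λ l t → next-injective (sym (isNext⇒≡next l i t)))) ⟩
    2                                                      ∎
    where
    open ≡-Reasoning
    disjoint : ∀ l → ¬ (T (isNext i l) × T (isNext l i))
    disjoint l (p , q) = next²≢id 2<n l (trans (cong next (sym (isNext⇒≡next l i q))) (sym (isNext⇒≡next i l p)))
    unique : (f : Fin n → Bool) → ∀ {x} → T (f x) → (∀ l → T (f l) → l ≡ x) → sum (χ ∘ f) ≡ 1
    unique f {x} fx u = begin
      sum (χ ∘ f)     ≡⟨ sym (∣tabulate∣ f) ⟩
      ∣ tabulate f ∣  ≡⟨ cong ∣_∣ (⊆-antisym (λ {l} l∈ → subst (_∈ ⁅ x ⁆) (sym (u l (∈-tabulate⁻ f l∈))) (x∈⁅x⁆ x))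
                           (λ {l} l∈ → subst (_∈ tabulate f) (sym (x∈⁅y⁆⇒x≡y x l∈)) (∈-tabulate⁺ f fx))) ⟩
      ∣ ⁅ x ⁆ ∣       ≡⟨ ∣⁅x⁆∣≡1 x ⟩
      1               ∎

-- Adjacency and degrees in direct products.

×-adj : ∀ {m n} (G : Graph m) (H : Graph n) u i v j → (G ×ᴳ H) (combine u i) (combine v j) ≡ G u v ∧ H i j
×-adj G H u i v j = cong₂ (λ (x₁ , y₁) (x₂ , y₂) → G x₁ x₂ ∧ H y₁ y₂) (remQuot-combine u i) (remQuot-combine v j)

×-adj⁺ : ∀ {m n} (G : Graph m) (H : Graph n) u i v j → Adj G u v → Adj H i j → Adj (G ×ᴳ H) (combine u i) (combine v j)
×-adj⁺ G H u i v j p q = subst T (sym (×-adj G H u i v j)) (Equivalence.from T-∧ (p , q))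

×-adj⁻ : ∀ {m n} (G : Graph m) (H : Graph n) u i v j → Adj (G ×ᴳ H) (combine u i) (combine v j) → Adj G u v × Adj H i j
×-adj⁻ G H u i v j t = Equivalence.to T-∧ (subst T (×-adj G H u i v j) t)

×-sym : ∀ {m n} (G : Graph m) (H : Graph n) → (∀ u v → G u v ≡ G v u) → (∀ i j → H i j ≡ H j i) →
        ∀ p q → (G ×ᴳ H) p q ≡ (G ×ᴳ H) q p
×-sym {m} {n} G H Gs Hs p q with combine-surjective {m} {n} p | combine-surjective {m} {n} q
... | u , i , refl | v , j , refl = trans (×-adj G H u i v j) (trans (cong₂ _∧_ (Gs u v) (Hs i j)) (sym (×-adj G H v j u i)))

deg-× : ∀ {m n} (G : Graph m) (H : Graph n) u i → deg (G ×ᴳ H) (combine u i) ≡ deg G u * deg H i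
deg-× {m} {n} G H u i = begin
  deg (G ×ᴳ H) (combine u i)                                    ≡⟨ ∣tabulate∣ ((G ×ᴳ H) (combine u i)) ⟩
  sum (λ q → χ ((G ×ᴳ H) (combine u i) q))                      ≡⟨ sum-combine m _ ⟩
  sum (λ v → sum (λ j → χ ((G ×ᴳ H) (combine u i) (combine {m} {n} v j))))
    ≡⟨ sum-cong-≗ (λ v → sum-cong-≗ (λ j → trans (cong χ (×-adj G H u i v j)) (χ-∧ (G u v) (H i j)))) ⟩
  sum (λ v → sum (λ j → χ (G u v) * χ (H i j)))                 ≡⟨ sum-cong-≗ (λ v → sym (*-distribˡ-sum (χ (G u v)) (χ ∘ H i))) ⟩
  sum (λ v → χ (G u v) * sum (χ ∘ H i))                         ≡⟨ sym (*-distribʳ-sum (sum (χ ∘ H i)) (χ ∘ G u)) ⟩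
  sum (χ ∘ G u) * sum (χ ∘ H i)                                 ≡⟨ sym (cong₂ _*_ (∣tabulate∣ (G u)) (∣tabulate∣ (H i))) ⟩
  deg G u * deg H i                                             ∎
  where open ≡-Reasoning

-- Reachability, vertex cuts and connectivity.

module _ {n} {G : Graph n} {S : Subset n} where

  Reach-trans : ∀ {x y z} → Reach G S x y → Reach G S y z → Reach G S x z
  Reach-trans (here _)     s = s
  Reach-trans (step p a r) s = step p a (Reach-trans r s)

  Reach-start : ∀ {x y} → Reach G S x y → x ∉ S
  Reach-start (here p)     = p
  Reach-start (step p _ _) = p

  Reach-edge : ∀ {x y} → x ∉ S → y ∉ S → Adj G x y → Reach G S x y
  Reach-edge x∉ y∉ a = step x∉ a (here y∉)

  Reach-sym : (∀ u v → G u v ≡ G v u) → ∀ {x y} → Reach G S x y → Reach G S y x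
  Reach-sym Gs (here p)     = here p
  Reach-sym Gs (step {x} {w} p a r) = Reach-trans (Reach-sym Gs r) (Reach-edge (Reach-start r) p (subst T (Gs x w) a))

Reach-map : ∀ {m n} {G : Graph m} {H : Graph n} (φ : Fin m → Fin n) → (∀ x y → Adj G x y → Adj H (φ x) (φ y)) →
            (S : Subset n) → ∀ {x y} → Reach G (preimage φ S) x y → Reach H S (φ x) (φ y)
Reach-map φ h S (here p)             = here (p ∘ ∈-preimage⁺ φ S)
Reach-map φ h S (step {x} {w} p a r) = step (p ∘ ∈-preimage⁺ φ S) (h x w a) (Reach-map φ h S r)

-- Deleting the neighbourhood isolates `x`, while the non-neighbour `y` survives.
nbhd-cut : ∀ {n} (G : Graph n) → (∀ u → ¬ Adj G u u) → ∀ {x y} → x ≢ y → ¬ Adj G x y → IsVertexCut G (nbhd G x)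
nbhd-cut G irr {x} {y} x≢y x≁y = x , y , irr x ∘ ∈-tabulate⁻ (G x) , x≁y ∘ ∈-tabulate⁻ (G x) , λ
  { (here _)     → x≢y refl
  ; (step _ a r) → Reach-start r (∈-tabulate⁺ (G x) a) }

κ≤deg : ∀ {n} (G : Graph n) {k} → IsConnectivity G k → (∀ u → ¬ Adj G u u) → ∀ {x y} → x ≢ y → ¬ Adj G x y → k ≤ deg G x
κ≤deg G (_ , κ) irr {x} {y} x≢y x≁y = proj₂ (κ (λ c → x≁y (c x y x≢y))) (nbhd G x) (nbhd-cut G irr x≢y x≁y)

-- Non-reachability would make `S` a vertex cut below the minimum size.
∣S∣<κ⇒Reach : ∀ {n} (G : Graph n) {k S} → IsConnectivity G k → ¬ Complete G → ∣ S ∣ < k →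
              ∀ {x y} → x ∉ S → y ∉ S → ¬ ¬ Reach G S x y
∣S∣<κ⇒Reach G (_ , κ) nc lt {x} {y} x∉ y∉ ¬r = <⇒≱ lt (proj₂ (κ nc) _ (x , y , x∉ , y∉ , ¬r))


-- A t says that the layer t steps after the starting one lies in the component, and s t counts its
-- removed vertices; positions 0 and n are the same layer.
module CycleWalk
  (n d : ℕ) (0<d : 0 < d) (s : ℕ → ℕ)
  (othersEmpty : ∀ {u v w} → u < n → v < n → w < n → u ≢ v → u ≢ w → v ≢ w → d ≤ s u → d ≤ s v → s w ≡ 0)
  (≤d : ∀ {u v} → u < n → v < n → u ≢ v → d ≤ s v → s u ≤ d)
  (A : ℕ → Set)
  (s₀<d : s 0 < d) (sₙ<d : s n < d) (A₀ : A 0) (Aₙ : A n)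
  (forth : ∀ t → s t < d → A t → A (suc t))
  (back : ∀ t → s (suc t) < d → A (suc t) → A t)
  (squeeze : ∀ t → A t → A (2 + t) → A (suc t))
  (jump : ∀ t → s t ≤ d → A t → s (suc t) ≡ 0 → s (2 + t) ≡ 0 → A (suc t))
  where

  -- Walks forward from position 0; only the layers passed before `t` have to be small.
  ascend : ∀ t → (∀ w → w < t → s w < d) → A t
  ascend zero    small = A₀
  ascend (suc t) small = forth t (small t ≤-refl) (ascend t (λ w w<t → small w (m<n⇒m<1+n w<t)))

  -- Walks backward from position `n`, by induction on the remaining distance `j`.
  descend : ∀ j t → j + t ≡ n → (∀ w → t < w → w < n → s w < d) → A t
  descend zero    t refl small = Aₙ
  descend (suc j) t refl small with m≤n⇒m<n∨m≡n (s≤s (m≤n+m t j))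
  ... | inj₁ lt = back t (small (suc t) ≤-refl lt) (descend j (suc t) (+-suc j t) (λ w w> → small w (<-trans ≤-refl w>)))
  -- Here `suc t` is `n`, outside the range of `small`; the bound comes from `sₙ<d`.
  ... | inj₂ eq = back t (subst (λ z → s z < d) (sym eq) sₙ<d) (subst A (sym eq) Aₙ)

  -- Two layers with at least `d` removed vertices leave all others empty. This handles the arc
  -- strictly between them, which neither walk can enter by passing through `u` or `v`.
  module Between {u v} (u<v : u < v) (v<n : v < n) (d≤su : d ≤ s u) (d≤sv : d ≤ s v) where

    u<n : u < n
    u<n = <-trans u<v v<n

    empty : ∀ {w} → w < n → w ≢ u → w ≢ v → s w ≡ 0
    empty w<n w≢u w≢v = othersEmpty u<n v<n w<n (<⇒≢ u<v) (w≢u ∘ sym) (w≢v ∘ sym) d≤su d≤sv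

    small : ∀ {w} → w < n → w ≢ u → w ≢ v → s w < d
    small w<n w≢u w≢v = subst (_< d) (sym (empty w<n w≢u w≢v)) 0<d

    A-left : A u
    A-left = ascend u (λ w w<u → small (<-trans w<u u<n) (<⇒≢ w<u) (<⇒≢ (<-trans w<u u<v)))

    A-right : A v
    A-right = descend (n ∸ v) v (m∸n+n≡m (<⇒≤ v<n)) (λ w v<w w<n → small w<n (>⇒≢ (<-trans u<v v<w)) (>⇒≢ v<w))

    inside-empty : ∀ {w} → u < w → w < v → s w ≡ 0
    inside-empty u<w w<v = empty (<-trans w<v v<n) (>⇒≢ u<w) (<⇒≢ w<v)

    -- Entry into the arc: a single-layer arc has both its neighbours in the component, so `squeeze`
    -- applies; otherwise its first two layers are empty and `jump` applies.
    A-first : suc u < v → A (suc u)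
    A-first lt with m≤n⇒m<n∨m≡n lt
    ... | inj₁ lt′  = jump u (≤d u<n v<n (<⇒≢ u<v) d≤sv) A-left (inside-empty ≤-refl lt) (inside-empty (m<n⇒m<1+n ≤-refl) lt′)
    ... | inj₂ refl = squeeze u A-left A-right

    A-inside : ∀ j → suc j + u < v → A (suc j + u)
    A-inside zero    lt = A-first lt
    A-inside (suc j) lt = forth (suc j + u) (subst (_< d) (sym (inside-empty (s≤s (m≤n+m u j)) (<-trans ≤-refl lt))) 0<d)
                            (A-inside j (<-trans ≤-refl lt))

  everywhere : ∀ t → t < n → A t
  -- Looks for a layer with at least `d` removed vertices strictly before `t` and strictly after
  -- `t`; if one side has none, the walk from that side arrives.
  everywhere t t<n with anyUpTo? (λ w → d ≤? s w) t | anyUpTo? (λ w → (t <? w) ×-dec (d ≤? s w)) n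
  ... | no ¬left | _ = ascend t (λ w w<t → ≰⇒> (λ d≤ → ¬left (w , w<t , d≤)))
  ... | yes _ | no ¬right = descend (n ∸ t) t (m∸n+n≡m (<⇒≤ t<n)) (λ w t<w w<n → ≰⇒> (λ d≤ → ¬right (w , w<n , t<w , d≤)))
  ... | yes (u , u<t , d≤su) | yes (v , v<n , t<v , d≤sv) =
    subst A eq (Between.A-inside (<-trans u<t t<v) v<n d≤su d≤sv (t ∸ suc u) (subst (_< v) (sym eq) t<v))
    where
    eq : suc (t ∸ suc u) + u ≡ t
    eq = trans (sym (+-suc (t ∸ suc u) u)) (m∸n+n≡m u<t)

-- Non-adjacent pairs in products with a simple first factor.

module _ {m} (G : Graph m) (simple : Simple G) where

  adj-sym : ∀ u v → Adj G u v → Adj G v u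
  adj-sym u v = subst T (proj₁ simple u v)

  irreflexive : ∀ u → ¬ Adj G u u
  irreflexive u = subst T (proj₂ simple u)

  ×-irreflexive : ∀ {n} (H : Graph n) p → ¬ Adj (G ×ᴳ H) p p
  ×-irreflexive {n} H p a with combine-surjective {m} {n} p
  ... | u , i , refl = irreflexive u (proj₁ (×-adj⁻ G H u i u i a))

  ×-fibre-nonadjacent : ∀ {n} (H : Graph n) u i j → ¬ Adj (G ×ᴳ H) (combine u i) (combine u j)
  ×-fibre-nonadjacent H u i j a = irreflexive u (proj₁ (×-adj⁻ G H u i u j a))

  ×-incomplete : ∀ {n} (H : Graph n) (u : Fin m) {i j} → i ≢ j → ¬ Complete (G ×ᴳ H)
  ×-incomplete H u {i} {j} i≢j c = ×-fibre-nonadjacent H u i j (c _ _ (i≢j ∘ combine-injectiveʳ u i u j))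

  -- Two vertices over the same `u` are distinct and non-adjacent, so the neighbourhood of either
  -- one is a cut.
  κ≤deg-× : ∀ {n} (H : Graph n) {k} → IsConnectivity (G ×ᴳ H) k → ∀ u {i j} → i ≢ j → k ≤ deg G u * deg H i
  κ≤deg-× H {k} κ u {i} {j} i≢j = subst (k ≤_) (deg-× G H u i)
    (κ≤deg (G ×ᴳ H) κ (×-irreflexive H) (i≢j ∘ combine-injectiveʳ u i u j) (×-fibre-nonadjacent H u i j))

-- Sets of at most `2d` vertices containing no neighbourhood are not cuts.

module NoIsolatedVertex
  {m} (G : Graph m) (simple : Simple G)
  {n} .{{_ : NonZero n}}
  {k d} (κ₂ : IsConnectivity (G ×ᴳ K₂) k) (minDeg : IsMinDegree G d) (4d<nk : 4 * d < n * k)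
  (S : Subset (m * n)) (∣S∣≤2d : ∣ S ∣ ≤ d * 2)
  (noIsolated : ∀ x → ¬ nbhd (G ×ᴳ Cycle n) x ⊆ S)
  where

  H : Graph (m * n)
  H = G ×ᴳ Cycle n

  u₀ : Fin m
  u₀ = proj₁ (proj₁ minDeg)

  -- Every vertex of `K₂` has degree 1, so a vertex of `G ×ᴳ K₂` over `u₀` has degree `d`.
  k≤d : k ≤ d
  k≤d = subst (k ≤_) (trans (*-identityʳ _) (proj₂ (proj₁ minDeg))) (κ≤deg-× G simple K₂ κ₂ u₀ {zero} {suc zero} (λ ()))

  0<k : 0 < k
  0<k = n≢0⇒n>0 λ { refl → n≮0 (subst (4 * d <_) (*-zeroʳ n) 4d<nk) }

  0<d : 0 < d
  0<d = <-≤-trans 0<k k≤d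

  -- The `d` neighbours of `u₀` do not include `u₀` itself. Hence deleting at most `d` vertices
  -- never empties a layer.
  d<m : d < m
  d<m = subst (_< m) (proj₂ (proj₁ minDeg)) (∉⇒∣∣<n (irreflexive G simple u₀ ∘ ∈-tabulate⁻ (G u₀)))

  size : Fin n → ℕ
  size i = ∣ slice m S i ∣

  ∑size≤2d : sum size ≤ d * 2
  ∑size≤2d = subst (_≤ d * 2) (∣S∣≡∑∣slice∣ m n S) ∣S∣≤2d

  -- The `n` consecutive pairs count each layer twice, giving a total of at most `4d`, which is
  -- below `n * k`.
  ∃-light : ∃ λ p → size p + size (next p) < k
  ∃-light = sum<⇒∃< (λ i → size i + size (next i)) (begin-strict
    sum (λ i → size i + size (next i))   ≡⟨ ∑-distrib-+ size (size ∘ next) ⟩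
    -- `next` is the rotation by 1, a permutation of the layers, so it preserves the sum.
    sum size + sum (size ∘ next)         ≡⟨ cong (sum size +_) (sym (sum-permute size (rotation 1 (≤-<-trans z≤n (toℕ<n {n} (layer 0)))))) ⟩
    sum size + sum size                  ≤⟨ +-mono-≤ ∑size≤2d ∑size≤2d ⟩
    d * 2 + d * 2                        ≡⟨ sym (*-distribˡ-+ d 2 2) ⟩
    d * 4                                ≡⟨ *-comm d 4 ⟩
    4 * d                                <⟨ 4d<nk ⟩
    n * k                                ∎)
    where open ≤-Reasoning

  -- `φ` maps `G ×ᴳ K₂` onto the layers `i` and `next i`. The pullback of `S` has fewer than `k`
  -- vertices, so paths avoiding it can be transported back along `φ`.
  module Pair (i : Fin n) (light : size i + size (next i) < k) where

    end : Fin 2 → Fin n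
    end zero       = i
    end (suc zero) = next i

    end-adj : ∀ e e′ → Adj K₂ e e′ → Adj (Cycle n) (end e) (end e′)
    end-adj zero       (suc zero) _ = Cycle-next i
    end-adj (suc zero) zero       _ = Cycle-next⁻ i
    end-adj (suc zero) (suc zero) ()

    φ : Fin (m * 2) → Fin (m * n)
    φ q = combine (proj₁ (remQuot {m} 2 q)) (end (proj₂ (remQuot {m} 2 q)))

    φ-combine : ∀ (u : Fin m) e → φ (combine u e) ≡ combine u (end e)
    φ-combine u e = cong (λ (v , e′) → combine v (end e′)) (remQuot-combine u e)

    φ-adj : ∀ x y → Adj (G ×ᴳ K₂) x y → Adj H (φ x) (φ y)
    φ-adj x y a with combine-surjective {m} {2} x | combine-surjective {m} {2} y
    ... | u , e , refl | v , e′ , refl = subst₂ (Adj H) (sym (φ-combine u e)) (sym (φ-combine v e′))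
      (×-adj⁺ G (Cycle n) u (end e) v (end e′) (proj₁ (×-adj⁻ G K₂ u e v e′ a)) (end-adj e e′ (proj₂ (×-adj⁻ G K₂ u e v e′ a))))

    slice-preimage : ∀ e → slice m (preimage φ S) e ≡ slice m S (end e)
    slice-preimage e = tabulate-cong (λ u → trans (lookup∘tabulate _ (combine u e)) (cong (lookup S) (φ-combine u e)))

    ∣preimage∣<k : ∣ preimage φ S ∣ < k
    ∣preimage∣<k = subst (_< k) (sym (begin
      ∣ preimage φ S ∣                               ≡⟨ ∣S∣≡∑∣slice∣ m 2 (preimage φ S) ⟩
      sum (λ e → ∣ slice m (preimage φ S) e ∣)       ≡⟨ sum-cong-≗ (λ e → cong ∣_∣ (slice-preimage e)) ⟩
      size i + (size (next i) + 0)                   ≡⟨ cong (size i +_) (+-identityʳ _) ⟩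
      size i + size (next i)                         ∎)) light
      where open ≡-Reasoning

    connected : ∀ (u : Fin m) e (v : Fin m) e′ → combine u (end e) ∉ S → combine v (end e′) ∉ S →
                ¬ ¬ Reach H S (combine u (end e)) (combine v (end e′))
    connected u e v e′ ∉₁ ∉₂ ¬r = ∣S∣<κ⇒Reach (G ×ᴳ K₂) κ₂ (×-incomplete G simple K₂ u₀ {zero} {suc zero} (λ ())) ∣preimage∣<k
      (outside u e ∉₁) (outside v e′ ∉₂)
      (λ r → ¬r (subst₂ (Reach H S) (φ-combine u e) (φ-combine v e′) (Reach-map {G = G ×ᴳ K₂} {H = H} φ φ-adj S r)))
      where
      outside : ∀ (u : Fin m) e → combine u (end e) ∉ S → combine u e ∉ preimage φ S
      outside u e ∉ ∈ = ∉ (subst (_∈ S) (φ-combine u e) (∈-preimage⁻ φ S ∈))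

  ∃-remaining : ∀ i → size i < m → ∃ λ (u : Fin m) → combine u i ∉ S
  ∃-remaining i lt with ∣∣<⇒∃ ⊤ (slice m S i) (subst (size i <_) (sym (∣⊤∣≡n m)) lt)
  ... | u , _ , u∉ = u , u∉ ∘ ∈-preimage⁺ (λ u → combine u i) S

  -- `v` has at least `d` neighbours in `G`, too many for all their copies in layer `i` to be
  -- deleted.
  ∃-remaining-nbr : ∀ i v → size i < d → ∃ λ u → Adj G v u × combine u i ∉ S
  ∃-remaining-nbr i v lt with ∣∣<⇒∃ (nbhd G v) (slice m S i) (<-≤-trans lt (proj₂ minDeg v))
  ... | u , u∈ , u∉ = u , ∈-tabulate⁻ (G v) u∈ , u∉ ∘ ∈-preimage⁺ (λ u → combine u i) S

  light⇒size<d : ∀ {p} → size p + size (next p) < k → size p < d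
  light⇒size<d light = <-≤-trans (≤-<-trans (m≤m+n _ _) light) k≤d

  module Rooted (p : Fin n) (light : size p + size (next p) < k) (r : Fin m) (r∉S : combine r p ∉ S) where

    b : Fin (m * n)
    b = combine r p

    -- Doubly negated because κ only refutes the non-reachability of vertices outside small sets.
    Attached : Fin n → Set
    Attached i = ∀ (u : Fin m) → combine u i ∉ S → ¬ ¬ Reach H S b (combine u i)

    attach : ∀ x (u : Fin m) i → x ∉ S → combine u i ∉ S → Adj H x (combine u i) → ¬ ¬ Reach H S b x → ¬ ¬ Reach H S b (combine u i)
    attach x u i x∉ u∉ a ¬¬r ¬r = ¬¬r (λ r → ¬r (Reach-trans r (Reach-edge {G = H} x∉ u∉ a)))

    -- Each surviving vertex of layer `j` keeps a neighbour in layer `i`, and that neighbour is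
    -- already joined to the root.
    spread : ∀ {i j} → Adj (Cycle n) i j → size i < d → Attached i → Attached j
    spread {i} {j} i~j lt att v v∉ with ∃-remaining-nbr i v lt
    ... | u , v~u , u∉ = attach (combine u i) v j u∉ v∉ (×-adj⁺ G (Cycle n) u i v j (adj-sym G simple v u v~u) i~j) (att u u∉)

    -- `noIsolated` supplies a surviving neighbour; it must lie in one of the two adjacent layers,
    -- both attached.
    squeeze : ∀ i → Attached i → Attached (next (next i)) → Attached (next i)
    squeeze i att att″ v v∉ with ⊈⇒∃ (nbhd H (combine v (next i))) S (noIsolated _)
    ... | x , x∈ , x∉ with combine-surjective {m} {n} x
    ...   | u , j , refl with ×-adj⁻ G (Cycle n) v (next i) u j (∈-tabulate⁻ (H _) x∈)
    ...     | v~u , i′~j = attach (combine u j) v (next i) x∉ v∉ (×-adj⁺ G (Cycle n) u j v (next i) (adj-sym G simple v u v~u) (subst T (Cycle-sym (next i) j) i′~j))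
                             (att-j (Cycle⇒next (next i) j i′~j) u x∉)
      where
      att-j : j ≡ next (next i) ⊎ next i ≡ next j → Attached j
      att-j (inj₁ refl) = att″
      att-j (inj₂ eq)   = subst Attached (next-injective eq) att

    -- Layer `i` keeps a vertex `w` because `d < m`, and `w` has a neighbour `x` in the empty layer
    -- after it. The two empty layers form a light pair since `0 < k`, so `x` is connected to every
    -- vertex of its own layer.
    jump : ∀ i → size i ≤ d → Attached i → size (next i) ≡ 0 → size (next (next i)) ≡ 0 → Attached (next i)
    jump i le att empty′ empty″ v v∉ ¬r with ∃-remaining i (≤-<-trans le d<m)
    ... | w , w∉ with ∃-remaining-nbr (next i) w (subst (_< d) (sym empty′) 0<d)
    ...   | x , w~x , x∉ = attach (combine w i) x (next i) w∉ x∉ (×-adj⁺ G (Cycle n) w i x (next i) w~x (Cycle-next i)) (att w w∉)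
      (λ b⇝x → Pair.connected (next i) (subst (_< k) (sym (cong₂ _+_ empty′ empty″)) 0<k) x zero v zero x∉ v∉
        (λ x⇝v → ¬r (Reach-trans b⇝x x⇝v)))

    L : ℕ → Fin n
    L t = layer (toℕ p + t)

    L-suc : ∀ t → L (suc t) ≡ next (L t)
    L-suc t = trans (cong layer (+-suc (toℕ p) t)) (sym (next-layer (toℕ p + t)))

    L-suc² : ∀ t → L (2 + t) ≡ next (next (L t))
    L-suc² t = trans (L-suc (suc t)) (cong next (L-suc t))

    L₀ : L 0 ≡ p
    L₀ = trans (cong layer (+-identityʳ (toℕ p))) (layer-toℕ p)

    Lₙ : L n ≡ p
    Lₙ = trans (cong layer (+-comm (toℕ p) n)) (trans (layer-n+ (toℕ p)) (layer-toℕ p))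

    L-distinct : ∀ {u v} → u < n → v < n → u ≢ v → L u ≢ L v
    L-distinct u<n v<n u≢v = u≢v ∘ layer-injective (<⇒≤ (toℕ<n p)) u<n v<n

    L-surjective : ∀ i → ∃ λ t → t < n × L t ≡ i
    L-surjective i = toℕ t , toℕ<n t , layer-cancel (toℕ p) (n ∸ toℕ p) i (m+[n∸m]≡n (<⇒≤ (toℕ<n p)))
      where
      t : Fin n
      t = layer (n ∸ toℕ p + toℕ i)

    s : ℕ → ℕ
    s t = size (L t)

    -- Two layers with `d` removed vertices each already use the whole budget `2d`.
    othersEmpty : ∀ {u v w} → u < n → v < n → w < n → u ≢ v → u ≢ w → v ≢ w → d ≤ s u → d ≤ s v → s w ≡ 0
    othersEmpty {u} {v} {w} u<n v<n w<n u≢v u≢w v≢w d≤su d≤sv = n≤0⇒n≡0 (+-cancelˡ-≤ d _ _ (+-cancelˡ-≤ d _ _ (begin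
      d + (d + s w)        ≤⟨ +-mono-≤ d≤su (+-monoˡ-≤ (s w) d≤sv) ⟩
      s u + (s v + s w)    ≤⟨ threeTerms≤sum size (L-distinct u<n v<n u≢v) (L-distinct u<n w<n u≢w) (L-distinct v<n w<n v≢w) ⟩
      sum size             ≤⟨ ∑size≤2d ⟩
      d * 2                ≡⟨ *-comm d 2 ⟩
      d + (d + 0)          ∎)))
      where open ≤-Reasoning

    s≤d : ∀ {u v} → u < n → v < n → u ≢ v → d ≤ s v → s u ≤ d
    s≤d {u} {v} u<n v<n u≢v d≤sv = +-cancelˡ-≤ d _ _ (begin
      d + s u        ≤⟨ +-monoˡ-≤ (s u) d≤sv ⟩
      s v + s u      ≤⟨ twoTerms≤sum size (L-distinct v<n u<n (u≢v ∘ sym)) ⟩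
      sum size       ≤⟨ ∑size≤2d ⟩
      d * 2          ≡⟨ *-comm d 2 ⟩
      d + (d + 0)    ≡⟨ cong (d +_) (+-identityʳ d) ⟩
      d + d          ∎)
      where open ≤-Reasoning

    attached-p : Attached p
    attached-p u = Pair.connected p (light) r zero u zero r∉S

    attached-L : ∀ t → t < n → Attached (L t)
    attached-L = CycleWalk.everywhere n d 0<d s othersEmpty s≤d (Attached ∘ L)
      (subst (λ i → size i < d) (sym L₀) (light⇒size<d light))
      (subst (λ i → size i < d) (sym Lₙ) (light⇒size<d light))
      (subst Attached (sym L₀) attached-p)
      (subst Attached (sym Lₙ) attached-p)
      (λ t → spread (subst (Adj (Cycle n) (L t)) (sym (L-suc t)) (Cycle-next (L t))))
      (λ t → spread (subst (λ i → Adj (Cycle n) i (L t)) (sym (L-suc t)) (Cycle-next⁻ (L t))))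
      (λ t att att″ → subst Attached (sym (L-suc t)) (squeeze (L t) att (subst Attached (L-suc² t) att″)))
      (λ t le att e′ e″ → subst Attached (sym (L-suc t)) (jump (L t) le att
        (trans (cong size (sym (L-suc t))) e′) (trans (cong size (sym (L-suc² t))) e″)))

    attached : ∀ i → Attached i
    attached i with L-surjective i
    ... | t , t<n , refl = attached-L t t<n

    reachable : ∀ {x} → x ∉ S → ¬ ¬ Reach H S b x
    reachable {x} x∉ with combine-surjective {m} {n} x
    ... | u , i , refl = attached i u x∉

  -- Both ends of the alleged separation are joined to one root. The goal is a contradiction, so the
  -- doubly negated paths may be used as actual paths.
  notCut : ¬ IsVertexCut H S
  notCut (x , y , x∉ , y∉ , ¬r) =
    let p , light = ∃-light
        r , r∉S   = ∃-remaining p (<-trans (light⇒size<d light) d<m)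
    in Rooted.reachable p light r r∉S x∉ (λ b⇝x → Rooted.reachable p light r r∉S y∉ (λ b⇝y →
         ¬r (Reach-trans (Reach-sym (×-sym G (Cycle n) (proj₁ simple) Cycle-sym) b⇝x) b⇝y)))

-- Super-connectedness, by whether the minimum cut contains a neighbourhood.

theorem3p8 : ∀ {m} (G : Graph m) → Simple G → Connected G → ¬ Bipartite G →
    (n : ℕ) → 7 ≤ n → ¬ (2 ∣ n) →
    (k d : ℕ) → IsConnectivity (G ×ᴳ K₂) k → IsMinDegree G d →
    4 * d < (n ∸ 1) * k →
    SuperKappa (G ×ᴳ Cycle n)
theorem3p8 {m} G simple _ _ n@(suc n-1@(suc (suc _))) _ _ k d κ₂ minDeg@((u₀ , deg-u₀) , d≤deg) 4d<[n-1]k κ κ-conn S cut ∣S∣≡κ =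
  case any? (λ x → nbhd H x ⊆? S) of λ
    -- The chain `deg H x ≤ ∣ S ∣ ≤ d * 2 ≤ deg H w` makes `x` a vertex of minimum degree; taking
    -- `w = x` turns the inclusion into equality.
    { (yes (x , N⊆S)) → x , (λ w → ≤-trans (≤-trans (p⊆q⇒∣p∣≤∣q∣ N⊆S) ∣S∣≤2d) (2d≤deg w)) ,
        ⊆∧∣∣≥⇒≡ _ S N⊆S (≤-trans ∣S∣≤2d (2d≤deg x))
    ; (no none) → contradiction cut
        -- The averaging runs over all `n` pairs, so the bound with `n ∸ 1` is relaxed to `n`.
        (NoIsolatedVertex.notCut G simple κ₂ minDeg (<-≤-trans 4d<[n-1]k (*-monoˡ-≤ k (n≤1+n n-1))) S ∣S∣≤2d (λ x N⊆S → none (x , N⊆S))) }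
  where
  H : Graph (m * n)
  H = G ×ᴳ Cycle n

  ∣S∣≤2d : ∣ S ∣ ≤ d * 2
  ∣S∣≤2d = subst₂ _≤_ (sym ∣S∣≡κ) (cong₂ _*_ deg-u₀ (deg-Cycle {n} (s≤s (s≤s (s≤s z≤n))) zero))
    -- The vertex over `u₀` in layer 0 has degree `d * 2`; the one in layer 1 is the non-neighbour
    -- separated from it.
    (κ≤deg-× G simple (Cycle n) κ-conn u₀ {zero {n-1}} {suc zero} (λ ()))

  2d≤deg : ∀ x → d * 2 ≤ deg H x
  2d≤deg x with combine-surjective {m} {n} x
  ... | u , i , refl = subst (d * 2 ≤_) (sym (trans (deg-× G (Cycle n) u i) (cong (deg G u *_) (deg-Cycle (s≤s (s≤s (s≤s z≤n))) i))))
    (*-monoˡ-≤ 2 (d≤deg u))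
theorem3p8 G _ _ _ zero ()
theorem3p8 G _ _ _ (suc zero) (s≤s ())
theorem3p8 G _ _ _ (suc (suc zero)) (s≤s (s≤s ()))
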